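{- Let $B \ge 2$ be an integer and let $X = x_1, \dots, x_m$ be any sequence of searches over the keys $\{1,\dots,N\}$. Then $\mathrm{OPT}_{\mathrm{BST}}(X) = O(\mathrm{OPT}_{\mathrm{Btree}}(X) \cdot \log B)$, where $\mathrm{OPT}_{\mathrm{BST}}(X)$ and $\mathrm{OPT}_{\mathrm{Btree}}(X)$ denote the optimal offline costs of serving $X$ in the BST model and in the B-tree model with parameter $B$, respectively.
   Context: Keys are $\{1,\dots,N\}$; a search sequence is $X = x_1,\dots,x_m$ with each $x_i$ a key. BST model: the keys are stored in a binary search tree (one key per node, in-order condition). To serve search $x_i$, a single pointer is initialized at the root (unit cost), and then the algorithm performs unit-cost operations: move the pointer to the parent or to the left/right child of the current node, or rotate the edge between the current node and its parent. A node is touched when the pointer is at it; the search is correct if the node containing $x_i$ is touched. Nodes may store $O(\log N)$ extra bits. B-tree model with parameter $B\ge 2$: each node $v$ stores $n(v) \le B-1$ keys $x_1<\dots<x_{n(v)}$ and has $n(v)+1$ child pointers (possibly null), with the in-order condition (all keys in the $i$-th child subtree lie strictly between $x_{i-1}$ and $x_i$). To serve search $x_i$, a single pointer is initialized at the root (unit cost) and the algorithm performs unit-cost operations, and must touch the node containing $x_i$: (1) move the pointer to a child or the parent of the current node; (2) split a node $u$ with at least three keys at a key $u_m$ that is neither its smallest nor largest key, provided its parent is not full ($u_m$ is moved into the parent and $u$ is replaced by two nodes holding the keys smaller, resp. larger, than $u_m$; to split the root, first create a new empty root above it); (3) join two sibling nodes $u,v$ holding at most $B-2$ keys in total that are separated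 by a unique key $p_j$ of their parent $p$ ($p_j$ is moved down, $u$, $p_j$, $v$ become one node; if $p$ becomes empty it is removed); (4) rotate the edge between the current node $u$ and its parent $p(u)$: letting $P=\{p_1<\dots<p_m\}$ be the union of keys of $u$ and $p(u)$, the keys of $u$ form a contiguous interval $[p_\ell,p_r]$ of $P$, and the rotation replaces it by any other contiguous interval $[p_{\ell'},p_{r'}]$, redistributing keys (and subtrees) accordingly, as long as both nodes still hold at most $B-1$ keys. Nodes may store $O(B\log N)$ extra bits. The cost of an algorithm on $X$ is the total number of unit-cost operations; $\mathrm{OPT}$ in a model is the minimum cost over all offline algorithms in that model. For $B=2$ the B-tree model coincides with the BST model. -}

module Defs where

open import Data.Nat using (ℕ; zero; suc; _+_; _*_; _∸_; _≤_; _<_)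
open import Data.List using (List; []; _∷_; _++_; length; map; upTo)
open import Data.List.Relation.Unary.All using (All)
open import Data.List.Relation.Unary.Any using (Any)
open import Data.List.Membership.Propositional using (_∈_)
open import Data.Product using (Σ; _×_; _,_)
open import Relation.Binary.PropositionalEquality using (_≡_)
open import Relation.Nullary using (¬_)
open import Data.Empty using (⊥)

keysUpTo : ℕ → List ℕ
keysUpTo N = map suc (upTo N)

-- Generic execution framework for pointer-based search-tree models.
-- A configuration is a zipper: the subtree at the pointer ("focus")
-- together with the list of frames on the path back to the root
-- (innermost frame first).  A model supplies the one-step relation
-- (one unit-cost operation) and "the focused node contains key x".

module Exec {T F : Set}
            (plug : F → T → T)
            (Step : T × List F → T × List F → Set)
            (Touches : ℕ → T → Set) where

  Config : Set
  Config = T × List F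

  rebuild : T → List F → T
  rebuild t []       = t
  rebuild t (f ∷ fs) = rebuild (plug f t) fs

  treeOf : Config → T
  treeOf (t , fs) = rebuild t fs

  data Trace : Config → Config → List Config → Set where
    one  : ∀ c → Trace c c (c ∷ [])
    cons : ∀ {c c' d cs} → Step c c' → Trace c' d cs → Trace c d (c ∷ cs)

  -- Serve x t t' k : serving search x starting from tree t with the pointer
  -- at the root, touching the node containing x, ending with tree t',
  -- at total cost k = 1 (pointer initialisation) + number of operations
  -- = number of visited configurations.
  Serve : ℕ → T → T → ℕ → Set
  Serve x t t' k =
    Σ (List Config) λ cs → Σ Config λ d →
      Trace (t , []) d cs × Any (λ c → Touches x (Σ.proj₁ c)) cs
      × treeOf d ≡ t' × length cs ≡ k

  data ServeAll : T → List ℕ → ℕ → Set where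
    done : ∀ {t} → ServeAll t [] 0
    next : ∀ {t t' x xs k k'} → Serve x t t' k → ServeAll t' xs k'
         → ServeAll t (x ∷ xs) (k + k')

data BT : Set where
  leaf : BT
  node : BT → ℕ → BT → BT

inorder : BT → List ℕ
inorder leaf         = []
inorder (node l k r) = inorder l ++ k ∷ inorder r

ValidBST : ℕ → BT → Set
ValidBST N t = inorder t ≡ keysUpTo N

data BFrame : Set where
  wentL : ℕ → BT → BFrame
  wentR : BT → ℕ → BFrame

bplug : BFrame → BT → BT
bplug (wentL k r) t = node t k r
bplug (wentR l k) t = node l k t

data BSTStep : BT × List BFrame → BT × List BFrame → Set where
  up     : ∀ {t f fs} → BSTStep (t , f ∷ fs) (bplug f t , fs)
  downL  : ∀ {a j b k r fs} →
           BSTStep (node (node a j b) k r , fs) (node a j b , wentL k r ∷ fs)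
  downR  : ∀ {l k a j b fs} →
           BSTStep (node l k (node a j b) , fs) (node a j b , wentR l k ∷ fs)
  rotL   : ∀ {a u b p c fs} →
           BSTStep (node a u b , wentL p c ∷ fs) (node a u (node b p c) , fs)
  rotR   : ∀ {a p b u c fs} →
           BSTStep (node b u c , wentR a p ∷ fs) (node (node a p b) u c , fs)

BSTTouches : ℕ → BT → Set
BSTTouches x leaf         = ⊥   -- the pointer is never at an empty child
BSTTouches x (node l k r) = k ≡ x

module BST = Exec bplug BSTStep BSTTouches

data BTree : Set where
  nil  : BTree
  node : List ℕ → List BTree → BTree

mutual
  inorderB : BTree → List ℕ
  inorderB nil          = []
  inorderB (node ks cs) = interleave cs ks

  interleave : List BTree → List ℕ → List ℕ
  interleave []       ks       = ks
  interleave (c ∷ cs) []       = inorderB c ++ interleave cs []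
  interleave (c ∷ cs) (k ∷ ks) = inorderB c ++ k ∷ interleave cs ks

data WFB (B : ℕ) : BTree → Set where
  nil  : WFB B nil
  node : ∀ {ks cs} → 1 ≤ length ks → length ks ≤ B ∸ 1
       → length cs ≡ suc (length ks) → All (WFB B) cs → WFB B (node ks cs)

ValidBTree : ℕ → ℕ → BTree → Set
ValidBTree B N t = WFB B t × inorderB t ≡ keysUpTo N

data BTFrame : Set where
  frame : List ℕ → List BTree → List ℕ → List BTree → BTFrame

btplug : BTFrame → BTree → BTree
btplug (frame lk lc rk rc) t = node (lk ++ rk) (lc ++ t ∷ rc)

-- node resulting from a parent after a join; an emptied parent is removed
mkParent : List ℕ → List BTree → BTree
mkParent [] (c ∷ []) = c
mkParent ks cs       = node ks cs

data BTStep (B : ℕ) : BTree × List BTFrame → BTree × List BTFrame → Set where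
  up    : ∀ {t f fs} → BTStep B (t , f ∷ fs) (btplug f t , fs)
  down  : ∀ {ks cs lk rk lc c rc fs} →
          ks ≡ lk ++ rk → cs ≡ lc ++ c ∷ rc → length lc ≡ length lk →
          ¬ (c ≡ nil) →
          BTStep B (node ks cs , fs) (c , frame lk lc rk rc ∷ fs)
  split : ∀ {us ds ul um ur dl dr lk lc rk rc fs} →
          us ≡ ul ++ um ∷ ur → 1 ≤ length ul → 1 ≤ length ur →
          ds ≡ dl ++ dr → length dl ≡ suc (length ul) →
          length (lk ++ rk) < B ∸ 1 →
          BTStep B (node us ds , frame lk lc rk rc ∷ fs)
                   (node (lk ++ um ∷ rk) (lc ++ node ul dl ∷ node ur dr ∷ rc) , fs)
  -- split the root (a new empty root is created above it first)
  splitRoot : ∀ {us ds ul um ur dl dr} →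
          us ≡ ul ++ um ∷ ur → 1 ≤ length ul → 1 ≤ length ur →
          ds ≡ dl ++ dr → length dl ≡ suc (length ul) →
          BTStep B (node us ds , [])
                   (node (um ∷ []) (node ul dl ∷ node ur dr ∷ []) , [])
  join  : ∀ {ks cs kl k kr cl us ds vs es cr fs} →
          ks ≡ kl ++ k ∷ kr → cs ≡ cl ++ node us ds ∷ node vs es ∷ cr →
          length cl ≡ length kl →
          length us + length vs ≤ B ∸ 2 →
          BTStep B (node ks cs , fs)
                   (mkParent (kl ++ kr) (cl ++ node (us ++ k ∷ vs) (ds ++ es) ∷ cr) , fs)
  -- rotate the edge between the current node u and its parent:
  -- the merged in-order sequence of keys P and subtrees S is re-split,
  -- u receiving a new nonempty contiguous key interval P2 (with the
  -- subtrees S2 around it), the parent keeping the rest; pointer stays at u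
  rotate : ∀ {us ds lk lc rk rc P1 P2 P3 S1 S2 S3 fs} →
          lk ++ us ++ rk ≡ P1 ++ P2 ++ P3 →
          lc ++ ds ++ rc ≡ S1 ++ S2 ++ S3 →
          length S1 ≡ length P1 → length S2 ≡ suc (length P2) →
          1 ≤ length P2 → 1 ≤ length (P1 ++ P3) →
          length P2 ≤ B ∸ 1 → length (P1 ++ P3) ≤ B ∸ 1 →
          BTStep B (node us ds , frame lk lc rk rc ∷ fs)
                   (node P2 S2 , frame P1 S1 P3 S3 ∷ fs)

BTTouches : ℕ → BTree → Set
BTTouches x nil          = ⊥
BTTouches x (node ks cs) = x ∈ ks

module BTM (B : ℕ) = Exec btplug (BTStep B) BTTouches

{-# OPTIONS --safe #-}

-- The keys of every B-tree node are kept in a balanced (AVL) piece of the BST, at whose null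
-- pointers the pieces of its children hang.  Splitting a piece at a key and linking two
-- pieces through a key take O(log B) rotations, so a contiguous interval of the keys of a
-- piece can be isolated as a subtree M within O(log B) operations.  Declaring M to be a piece
-- of its own extracts a child node; isolating a hanging child and declaring its keys to be
-- part of the surrounding piece absorbs it.  Every split, join and rotation of the B-tree is
-- a composition of at most three such regroupings, of pieces with fewer than 4B keys, and
-- every pointer move is a walk through a piece, of height O(log B).

module Submission where

open import Defs
open import Data.Nat
open import Data.Nat.Properties
open import Data.Nat.Logarithm
open import Data.Nat.Tactic.RingSolver using (solve-∀)
open import Data.Empty using (⊥-elim)
open import Data.List using (List; []; _∷_; _++_; length)
open import Data.List.Properties using (++-assoc; length-++; ++-identityʳ; ∷-injective)
open import Data.List.Membership.Propositional using (_∈_)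
open import Data.List.Membership.Propositional.Properties using (∈-++⁻)
open import Data.List.Relation.Binary.Pointwise using (Pointwise; []; _∷_; Pointwise-length; ++⁺)
open import Data.List.Relation.Unary.All using (All; []; _∷_)
open import Data.List.Relation.Unary.Any using (Any; here; there)
open import Data.Product using (Σ; ∃-syntax; _×_; _,_; proj₁; proj₂)
open import Data.Sum using (_⊎_; inj₁; inj₂)
open import Function using (id)
open import Relation.Binary.Definitions using (tri<; tri≈; tri>)
open import Relation.Binary.PropositionalEquality
open import Relation.Nullary using (¬_)

-- Skeletons and rotations

-- A BST with a choice of where a piece ends: `hang` marks an opaque subtree and `erase` forgets the
-- marks. One BST has many skeletons, so a change of grouping alone costs nothing.
data Skel : Set where
  hang : BT → Skel
  nd   : Skel → ℕ → Skel → Skel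

erase : Skel → BT
erase (hang t)   = t
erase (nd l k r) = node (erase l) k (erase r)

keys : Skel → List ℕ
keys (hang _)   = []
keys (nd l k r) = keys l ++ k ∷ keys r

hangs : Skel → List BT
hangs (hang t)   = t ∷ []
hangs (nd l k r) = hangs l ++ hangs r

size : Skel → ℕ
size T = length (keys T)

size-nd : ∀ l k r → size (nd l k r) ≡ suc (size l + size r)
size-nd l k r = trans (length-++ (keys l)) (+-suc (size l) (size r))

length-hangs : ∀ T → length (hangs T) ≡ suc (size T)
length-hangs (hang _)   = refl
length-hangs (nd l k r) = begin
  length (hangs l ++ hangs r)         ≡⟨ length-++ (hangs l) ⟩
  length (hangs l) + length (hangs r) ≡⟨ cong₂ _+_ (length-hangs l) (length-hangs r) ⟩
  suc (size l + suc (size r))         ≡⟨ cong suc (sym (length-++ (keys l))) ⟩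
  suc (size (nd l k r))               ∎
  where open ≡-Reasoning

-- Reflection reduces linking with the taller tree on the left to linking with the taller tree on
-- the right.
mirror : Skel → Skel
mirror (hang t)   = hang t
mirror (nd l k r) = nd (mirror r) k (mirror l)

mirror-involutive : ∀ T → mirror (mirror T) ≡ T
mirror-involutive (hang t)   = refl
mirror-involutive (nd l k r) =
  cong₂ (λ a b → nd a k b) (mirror-involutive l) (mirror-involutive r)

infix 4 _⇒[_]_

-- The index is only an upper bound on the number of pointer operations.
data _⇒[_]_ : Skel → ℕ → Skel → Set where
  stay  : ∀ {T n} → T ⇒[ n ] T
  seq   : ∀ {T U V m n o} → T ⇒[ m ] U → U ⇒[ n ] V → m + n ≤ o → T ⇒[ o ] V
  rotʳ  : ∀ {a u b p c} → nd (nd a u b) p c ⇒[ 2 ] nd a u (nd b p c)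
  rotˡ  : ∀ {a u b p c} → nd a u (nd b p c) ⇒[ 2 ] nd (nd a u b) p c
  inL   : ∀ {l l′ k r n} → l ⇒[ n ] l′ → nd l k r ⇒[ 2 + n ] nd l′ k r
  inR   : ∀ {l k r r′ n} → r ⇒[ n ] r′ → nd l k r ⇒[ 2 + n ] nd l k r′

infixr 5 _then_

_then_ : ∀ {T U V m n} → T ⇒[ m ] U → U ⇒[ n ] V → T ⇒[ m + n ] V
p then q = seq p q ≤-refl

keys-⇒ : ∀ {T U n} → T ⇒[ n ] U → keys T ≡ keys U
keys-⇒ stay        = refl
keys-⇒ (seq p q _) = trans (keys-⇒ p) (keys-⇒ q)
keys-⇒ (rotʳ {a})  = ++-assoc (keys a) _ _
keys-⇒ (rotˡ {a})  = sym (++-assoc (keys a) _ _)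
keys-⇒ (inL p)     = cong (_++ _) (keys-⇒ p)
keys-⇒ (inR {l} {k} p) = cong (λ ks → keys l ++ k ∷ ks) (keys-⇒ p)

hangs-⇒ : ∀ {T U n} → T ⇒[ n ] U → hangs T ≡ hangs U
hangs-⇒ stay        = refl
hangs-⇒ (seq p q _) = trans (hangs-⇒ p) (hangs-⇒ q)
hangs-⇒ (rotʳ {a} {b = b})  = ++-assoc (hangs a) (hangs b) _
hangs-⇒ (rotˡ {a} {b = b})  = sym (++-assoc (hangs a) (hangs b) _)
hangs-⇒ (inL p)     = cong (_++ _) (hangs-⇒ p)
hangs-⇒ (inR {l} p) = cong (hangs l ++_) (hangs-⇒ p)

mirror-⇒ : ∀ {T U n} → T ⇒[ n ] U → mirror T ⇒[ n ] mirror U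
mirror-⇒ stay        = stay
mirror-⇒ (seq p q b) = seq (mirror-⇒ p) (mirror-⇒ q) b
mirror-⇒ rotʳ        = rotˡ
mirror-⇒ rotˡ        = rotʳ
mirror-⇒ (inL p)     = inR (mirror-⇒ p)
mirror-⇒ (inR p)     = inL (mirror-⇒ p)

-- Balancing, linking and splitting

data AVL : ℕ → Skel → Set where
  hang  : ∀ {t} → AVL 0 (hang t)
  even  : ∀ {n l k r} → AVL n l → AVL n r → AVL (suc n) (nd l k r)
  left  : ∀ {n l k r} → AVL (suc n) l → AVL n r → AVL (2 + n) (nd l k r)
  right : ∀ {n l k r} → AVL n l → AVL (suc n) r → AVL (2 + n) (nd l k r)

mirror-AVL : ∀ {n T} → AVL n T → AVL n (mirror T)
mirror-AVL hang        = hang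
mirror-AVL (even a b)  = even (mirror-AVL b) (mirror-AVL a)
mirror-AVL (left a b)  = right (mirror-AVL b) (mirror-AVL a)
mirror-AVL (right a b) = left (mirror-AVL b) (mirror-AVL a)

data Grown (n : ℕ) (T : Skel) : Set where
  same : AVL n T → Grown n T
  grew : AVL (suc n) T → Grown n T

-- Repairs a left side two levels higher than the right by a single rotation or, at cost 6, a double
-- one. Only the `even` case raises the height.
rebalance : ∀ {n T k R} → AVL (2 + n) T → AVL n R →
            ∃[ U ] (nd T k R ⇒[ 6 ] U) × Grown (2 + n) U
rebalance (even a b) r = _ , seq rotʳ (stay {n = 0}) (s≤s (s≤s z≤n)) , grew (right a (left b r))
rebalance (left a b) r = _ , seq rotʳ (stay {n = 0}) (s≤s (s≤s z≤n)) , same (even a (even b r))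
rebalance (right a (even b c)) r  = _ , inL rotˡ then rotʳ , same (even (even a b) (even c r))
rebalance (right a (left b c)) r  = _ , inL rotˡ then rotʳ , same (even (even a b) (right c r))
rebalance (right a (right b c)) r = _ , inL rotˡ then rotʳ , same (even (left a b) (even c r))

-- The cost is at most ten times the difference of the heights, stated with sums to avoid truncated
-- subtraction.
LinkR : ℕ → ℕ → Skel → ℕ → Skel → Set
LinkR m n L k R = ∃[ T ] ∃[ c ] (nd L k R ⇒[ c ] T) × c + 10 * m ≤ 10 * n × Grown n T

private
  deeper : ∀ c m n {n′} → c + 10 * m ≤ 10 * n → suc n ≤ n′ → 10 + c + 10 * m ≤ 10 * n′
  deeper c m n p q = ≤-trans (+-monoʳ-≤ 10 p)
    (≤-trans (≤-reflexive (sym (*-suc 10 n))) (*-monoʳ-≤ 10 q))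

  -- Rotating `j` above `k` moves the link one level down the left spine of the right tree. The 10
  -- covers this rotation (2), entering and leaving the left child (2) and a rebalancing (6).
  descendL : ∀ {L k C j D T U c} → nd L k C ⇒[ c ] T → nd T j D ⇒[ 6 ] U →
             nd L k (nd C j D) ⇒[ 10 + c ] U
  descendL {c = c} p q = seq rotˡ (inL p then q) (≤-reflexive (lem c))
    where lem : ∀ c → 2 + (2 + c + 6) ≡ 10 + c
          lem = solve-∀

-- The link descends the left spine of `R` until the heights fit, puts `k` there with `L` on its
-- left, and rebalances on the way back.
linkR : ∀ {m n L k R} → AVL m L → AVL n R → m ≤ n → LinkR m n L k R
linkR hang hang z≤n = _ , 0 , stay , z≤n , grew (even hang hang)
linkR {m} {suc n} a (even b c) m≤n with m≤n⇒m<n∨m≡n m≤n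
... | inj₂ refl = _ , 0 , stay , ≤-refl , grew (even a (even b c))
... | inj₁ (s≤s m≤) with linkR a b m≤
...   | _ , c₀ , p , e , same t = _ , _ , descendL p stay , deeper c₀ m n e ≤-refl , same (even t c)
...   | _ , c₀ , p , e , grew t = _ , _ , descendL p stay , deeper c₀ m n e ≤-refl , grew (left t c)
linkR {m} {suc (suc n)} a (left b c) m≤n with m≤n⇒m<n∨m≡n m≤n
... | inj₂ refl = _ , 0 , stay , ≤-refl , grew (even a (left b c))
... | inj₁ (s≤s m≤) with linkR a b m≤
...   | _ , c₀ , p , e , same t = _ , _ , descendL p stay , deeper c₀ m (suc n) e ≤-refl , same (left t c)
...   | _ , c₀ , p , e , grew t with rebalance t c
...     | _ , q , g = _ , _ , descendL p q , deeper c₀ m (suc n) e ≤-refl , g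
linkR {m} {suc (suc n)} a (right b c) m≤n with m≤n⇒m<n∨m≡n m≤n
... | inj₂ refl = _ , 0 , stay , ≤-refl , grew (even a (right b c))
... | inj₁ (s≤s m≤) with m≤n⇒m<n∨m≡n m≤
-- The left child of `R` is one level lower than `L`, so the descent stops above it and the new root
-- leans right.
...   | inj₂ refl = _ , 0 , stay , *-monoʳ-≤ 10 (n≤1+n m) , grew (right a (right b c))
...   | inj₁ (s≤s m≤′) with linkR a b m≤′
...     | _ , c₀ , p , e , same t = _ , _ , descendL p stay , deeper c₀ m n e (n≤1+n _) , same (right t c)
...     | _ , c₀ , p , e , grew t = _ , _ , descendL p stay , deeper c₀ m n e (n≤1+n _) , same (even t c)

-- `height≤` bounds the height by one more than the maximum of `m` and `n`. `cost≤` charges the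
-- rotations to the growth from the lower of the two heights to the height of the result, a form
-- that telescopes along a split.
record Link (m n : ℕ) (L : Skel) (k : ℕ) (R : Skel) : Set where
  constructor linked
  field
    {tree}        : Skel
    {cost height} : ℕ
    run           : nd L k R ⇒[ cost ] tree
    avl           : AVL height tree
    height≤       : ∀ {q} → m < q → n < q → height ≤ q
    cost≤         : cost + 10 * (m ⊓ n) ≤ 10 * height

mirror-Link : ∀ {m n L k R} → Link n m (mirror R) k (mirror L) → Link m n L k R
mirror-Link {m} {n} {L} {k} {R} (linked {cost = c} {height = h} r a z w) =
  linked (subst₂ (λ L R → nd L k R ⇒[ _ ] _) (mirror-involutive L) (mirror-involutive R) (mirror-⇒ r))
         (mirror-AVL a) (λ p q → z q p) (subst (λ i → c + 10 * i ≤ 10 * h) (⊓-comm n m) w)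

link≤ : ∀ {m n L k R} → AVL m L → AVL n R → m ≤ n → Link m n L k R
link≤ {m} {n} a b m≤n with linkR a b m≤n
... | _ , c , p , e , same t = linked p t (λ _ → <⇒≤)
        (subst (λ i → c + 10 * i ≤ 10 * n) (sym (m≤n⇒m⊓n≡m m≤n)) e)
... | _ , c , p , e , grew t = linked p t (λ _ n<q → n<q)
        (subst (λ i → c + 10 * i ≤ 10 * suc n) (sym (m≤n⇒m⊓n≡m m≤n)) (≤-trans e (*-monoʳ-≤ 10 (n≤1+n n))))

link : ∀ {m n L k R} → AVL m L → AVL n R → Link m n L k R
link {m} {n} a b with ≤-total m n
... | inj₁ m≤n = link≤ a b m≤n
... | inj₂ n≤m = mirror-Link (link≤ (mirror-AVL b) (mirror-AVL a) n≤m)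

record Subtrees (h : ℕ) (L R : Skel) : Set where
  constructor subtrees
  field
    {m n}   : ℕ
    avlˡ    : AVL m L
    avlʳ    : AVL n R
    m<h     : m < h
    n<h     : n < h
    m≤1+n   : m ≤ suc n
    n≤1+m   : n ≤ suc m

children : ∀ {h L k R} → AVL h (nd L k R) → Subtrees h L R
children (even a b)  = subtrees a b ≤-refl ≤-refl (n≤1+n _) (n≤1+n _)
children (left a b)  = subtrees a b ≤-refl (n≤1+n _) ≤-refl (m≤n⇒m≤1+n (n≤1+n _))
children (right a b) = subtrees a b (n≤1+n _) ≤-refl (m≤n⇒m≤1+n (n≤1+n _)) ≤-refl

-- Measuring the cost by the heights of the two parts lets the induction pay for the links. The 16
-- per level consists of 6 for a rotation and for entering two children, and of 10 for a part that
-- may be one level higher than the tree it is linked with.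
record Split (h : ℕ) (T : Skel) (i : ℕ) : Set where
  constructor splitted
  field
    {L R}             : Skel
    {x cost hˡ hʳ}    : ℕ
    run    : T ⇒[ cost ] nd L x R
    size≡  : size L ≡ i
    avlˡ   : AVL hˡ L
    avlʳ   : AVL hʳ R
    hˡ≤    : hˡ ≤ h
    hʳ≤    : hʳ ≤ h
    cost≤  : cost ≤ 10 * (hˡ + hʳ) + 16 * h

-- The links made along a split telescope: each costs about the growth of one of the two parts.
split-cost : ∀ c x y a n j g {h} → c ≤ 10 * (x + y) + 16 * a → suc a ≤ h →
             y ≤ suc n → j + 10 * (y ⊓ n) ≤ 10 * g →
             2 + c + (2 + (2 + j)) ≤ 10 * (x + g) + 16 * h
split-cost c x y a n j g {h} p q r e = begin
  2 + c + (2 + (2 + j))                          ≡⟨ lem₁ c j ⟩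
  c + (6 + j)                                    ≤⟨ +-monoˡ-≤ _ p ⟩
  10 * (x + y) + 16 * a + (6 + j)                ≤⟨ +-monoˡ-≤ (6 + j) (+-monoˡ-≤ (16 * a)
                                                      (*-monoʳ-≤ 10 (+-monoʳ-≤ x (⊓-glb (n≤1+n y) r)))) ⟩
  10 * (x + suc (y ⊓ n)) + 16 * a + (6 + j)      ≡⟨ lem₂ x (y ⊓ n) a j ⟩
  10 * x + (j + 10 * (y ⊓ n)) + 16 * suc a       ≤⟨ +-mono-≤ (+-monoʳ-≤ (10 * x) e) (*-monoʳ-≤ 16 q) ⟩
  10 * x + 10 * g + 16 * h                       ≡⟨ cong (_+ 16 * h) (sym (*-distribˡ-+ 10 x g)) ⟩
  10 * (x + g) + 16 * h                          ∎
  where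
    open ≤-Reasoning
    lem₁ : ∀ c j → 2 + c + (2 + (2 + j)) ≡ c + (6 + j)
    lem₁ = solve-∀
    lem₂ : ∀ x i a j → 10 * (x + suc i) + 16 * a + (6 + j) ≡ 10 * x + (j + 10 * i) + 16 * suc a
    lem₂ = solve-∀

-- The wanted key is brought to the root of a child recursively and then rotated above `j`. One part
-- of that child is now a sibling of the other child below `j`, and these two are linked through
-- `j`.
splitAt : ∀ {h T} → AVL h T → ∀ i → i < size T → Split h T i
splitAt {h} {nd A j C} t i i<n with children t | <-cmp i (size A)
... | subtrees a b m<h n<h _ _ | tri≈ _ i≡ _ =
  splitted stay (sym i≡) a b (<⇒≤ m<h) (<⇒≤ n<h) (z≤n {_})
... | subtrees {m} {n} a b m<h n<h m≤1+n _ | tri< i< _ _ with splitAt a i i<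
...   | splitted {cost = c} {hˡ} {hʳ} p s l r hˡ≤ hʳ≤ c≤ with link {k = j} r b
...     | linked {cost = c′} {height = h′} q t′ h≤ c≤′ =
  splitted (inL p then rotʳ then inR q) s l t′ (≤-trans hˡ≤ (<⇒≤ m<h))
    (h≤ (≤-<-trans hʳ≤ m<h) n<h) (split-cost c hˡ hʳ m n c′ h′ c≤ m<h (≤-trans hʳ≤ m≤1+n) c≤′)
splitAt {h} {nd A j C} t i i<n | subtrees {m} {n} a b m<h n<h _ n≤1+m | tri> _ _ i>
  with splitAt b (i ∸ suc (size A)) (+-cancelˡ-< (suc (size A)) _ _
         (subst₂ _<_ (sym (m+[n∸m]≡n i>)) (size-nd A j C) i<n))
... | splitted {L = C₁} {cost = c} {hˡ} {hʳ} p s l r hˡ≤ hʳ≤ c≤ with link {k = j} a l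
...   | linked {cost = c′} {height = h′} q t′ h≤ c≤′ =
  splitted (inR p then rotˡ then inL q) size≡i t′ r (h≤ m<h (≤-<-trans hˡ≤ n<h)) (≤-trans hʳ≤ (<⇒≤ n<h))
    (subst (λ z → 2 + c + (4 + c′) ≤ 10 * z + 16 * h) (+-comm hʳ h′)
      (split-cost c hʳ hˡ n m c′ h′ (subst (λ z → c ≤ 10 * z + 16 * n) (+-comm hˡ hʳ) c≤) n<h
        (≤-trans hˡ≤ n≤1+m) (subst (λ z → c′ + 10 * z ≤ 10 * h′) (⊓-comm m hˡ) c≤′)))
  where
    size≡i = begin
      _                                                   ≡⟨ cong length (sym (keys-⇒ q)) ⟩
      size (nd A j C₁)                                    ≡⟨ size-nd A j C₁ ⟩
      suc (size A) + size C₁                              ≡⟨ cong (suc (size A) +_) s ⟩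
      suc (size A) + (i ∸ suc (size A))                   ≡⟨ m+[n∸m]≡n i> ⟩
      i                                                   ∎
      where open ≡-Reasoning

-- Heights

-- Both children have height at least `h - 2`, so the number of hanging trees at least doubles every
-- two levels.
2^⌈height/2⌉≤1+size : ∀ {h T} → AVL h T → 2 ^ ⌈ h /2⌉ ≤ suc (size T)
2^⌈height/2⌉≤1+size hang = ≤-refl
2^⌈height/2⌉≤1+size {T = nd l k r} t = go t
  where
    both : ∀ n → 2 ^ ⌈ n /2⌉ ≤ suc (size l) → 2 ^ ⌈ n /2⌉ ≤ suc (size r) →
           2 ^ suc ⌈ n /2⌉ ≤ suc (size (nd l k r))
    both n p q = begin
      2 ^ ⌈ n /2⌉ + (2 ^ ⌈ n /2⌉ + 0) ≤⟨ +-mono-≤ p (≤-trans (≤-reflexive (+-identityʳ _)) q) ⟩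
      suc (size l) + suc (size r)     ≡⟨ cong suc (sym (length-++ (keys l))) ⟩
      suc (size (nd l k r))           ∎
      where open ≤-Reasoning
    weaken : ∀ n {x} → 2 ^ ⌈ suc n /2⌉ ≤ x → 2 ^ ⌈ n /2⌉ ≤ x
    weaken n = ≤-trans (^-monoʳ-≤ 2 (⌈n/2⌉-mono (n≤1+n n)))
    go : ∀ {h} → AVL h (nd l k r) → 2 ^ ⌈ h /2⌉ ≤ suc (size (nd l k r))
    go (even {n} a b)  = weaken (suc n) (both n (2^⌈height/2⌉≤1+size a) (2^⌈height/2⌉≤1+size b))
    go (left {n} a b)  = both n (weaken n (2^⌈height/2⌉≤1+size a)) (2^⌈height/2⌉≤1+size b)
    go (right {n} a b) = both n (2^⌈height/2⌉≤1+size a) (weaken n (2^⌈height/2⌉≤1+size b))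

1≤⌊log₂⌋ : ∀ {B} → 2 ≤ B → 1 ≤ ⌊log₂ B ⌋
1≤⌊log₂⌋ = ⌊log₂⌋-mono-≤

height≤6log : ∀ {B h T} → 2 ≤ B → AVL h T → size T < 4 * B → h ≤ 6 * ⌊log₂ B ⌋
height≤6log {B@(suc _)} {h} {T} 2≤B t s< = begin
  h                        ≡⟨ sym (⌊n/2⌋+⌈n/2⌉≡n h) ⟩
  ⌊ h /2⌋ + ⌈ h /2⌉        ≤⟨ +-monoˡ-≤ ⌈ h /2⌉ (⌊n/2⌋≤⌈n/2⌉ h) ⟩
  ⌈ h /2⌉ + ⌈ h /2⌉        ≤⟨ +-mono-≤ half≤ half≤ ⟩
  3 * ℓ + 3 * ℓ            ≡⟨ sym (*-distribʳ-+ ℓ 3 3) ⟩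
  6 * ℓ                    ∎
  where
    open ≤-Reasoning
    ℓ = ⌊log₂ B ⌋
    half≤ : ⌈ h /2⌉ ≤ 3 * ℓ
    half≤ = begin
      ⌈ h /2⌉                   ≡⟨ sym (⌊log₂[2^n]⌋≡n ⌈ h /2⌉) ⟩
      ⌊log₂ (2 ^ ⌈ h /2⌉) ⌋     ≤⟨ ⌊log₂⌋-mono-≤ (≤-trans (2^⌈height/2⌉≤1+size t) s<) ⟩
      ⌊log₂ (4 * B) ⌋           ≡⟨ cong ⌊log₂_⌋ (*-assoc 2 2 B) ⟩
      ⌊log₂ (2 * (2 * B)) ⌋     ≡⟨ ⌊log₂[2*b]⌋≡1+⌊log₂b⌋ (2 * B) ⟩
      suc ⌊log₂ (2 * B) ⌋       ≡⟨ cong suc (⌊log₂[2*b]⌋≡1+⌊log₂b⌋ B) ⟩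
      -- The two doublings in `4 * B` are absorbed because `B` is at least 2, which makes `ℓ` at
      -- least 1.
      2 + ℓ                     ≤⟨ +-monoˡ-≤ ℓ (*-monoʳ-≤ 2 (1≤⌊log₂⌋ 2≤B)) ⟩
      2 * ℓ + ℓ                 ≡⟨ +-comm (2 * ℓ) ℓ ⟩
      3 * ℓ                     ∎

-- Pointer moves

data Steps : BST.Config → BST.Config → ℕ → Set where
  halt : ∀ {c n} → Steps c c n
  step : ∀ {c d e n} → BSTStep c d → Steps d e n → Steps c e (suc n)

loosen : ∀ {c d m n} → m ≤ n → Steps c d m → Steps c d n
loosen _       halt       = halt
loosen (s≤s p) (step s q) = step s (loosen p q)

_⊕_ : ∀ {c d e m n} → Steps c d m → Steps d e n → Steps c e (m + n)
_⊕_ {m = m} halt q = loosen (m≤n+m _ m) q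
step s p ⊕ q       = step s (p ⊕ q)

-- The pointer starts and ends at the root of the subtree; quantifying over the stack makes the run
-- usable at any position.
Local : BT → BT → ℕ → Set
Local s s′ n = ∀ fs → Steps (s , fs) (s′ , fs) n

-- A hanging tree may be empty, where the pointer cannot go; since it never changes, nothing has to
-- be run there.
hang-⇒ : ∀ {t U n} → hang t ⇒[ n ] U → U ≡ hang t
hang-⇒ stay        = refl
hang-⇒ (seq p q _) with hang-⇒ p
... | refl = hang-⇒ q

-- This accounts for each 2 in the rules: a rotation is preceded by a move to the child and returns
-- the pointer to the root, and work inside a child needs one move down and one up.
run : ∀ {T U n} → T ⇒[ n ] U → Local (erase T) (erase U) n
run stay fs        = halt
run (seq p q b) fs = loosen b (run p fs ⊕ run q fs)
run rotʳ fs        = step downL (step rotL halt)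
run rotˡ fs        = step downR (step rotR halt)
run {nd (hang t) _ _} (inL p) fs with hang-⇒ p
... | refl = halt
run {nd (nd a u b) k r} (inL {n = n} p) fs =
  step downL (loosen (≤-reflexive (+-comm n 1)) (run p _ ⊕ step {n = 0} up halt))
run {nd _ _ (hang t)} (inR p) fs with hang-⇒ p
... | refl = halt
run {nd l k (nd a u b)} (inR {n = n} p) fs =
  step downR (loosen (≤-reflexive (+-comm n 1)) (run p _ ⊕ step {n = 0} up halt))

-- Regrouping

++-injective : ∀ {A : Set} (as bs : List A) {xs ys} → length as ≡ length bs →
               as ++ xs ≡ bs ++ ys → as ≡ bs × xs ≡ ys
++-injective []       []       _  eq = refl , eq
++-injective (a ∷ as) (b ∷ bs) le eq with ∷-injective eq
... | refl , eq′ with ++-injective as bs (suc-injective le) eq′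
...   | refl , eq″ = refl , eq″

-- A surrounding of a subtree that can be merged with whatever subtree fills it;
-- f and g describe how the keys and the hanging trees of the filling are extended.
record Context (q : ℕ) (f : List ℕ → List ℕ) (g : List BT → List BT) : Set where
  field
    fill       : Skel → Skel
    erase-fill : ∀ {M M′} → erase M ≡ erase M′ → erase (fill M) ≡ erase (fill M′)
    keys-fill  : ∀ M → keys (fill M) ≡ f (keys M)
    hangs-fill : ∀ M → hangs (fill M) ≡ g (hangs M)
    cong-fill  : ∀ {M M′ n} → M ⇒[ n ] M′ → fill M ⇒[ 2 + n ] fill M′
    close      : ∀ {h r M} → AVL h M → h ≤ r → q ≤ r →
                 ∃[ T ] ∃[ h′ ] (fill M ⇒[ 10 * suc r ] T) × AVL h′ T × h′ ≤ suc r

open Context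

-- Serves an interval that reaches the end of the piece on one side, where nothing surrounds it.
trivial : ∀ {q f g} → (∀ ks → ks ≡ f ks) → (∀ ts → ts ≡ g ts) → Context q f g
trivial f≗ g≗ = record
  { fill       = id
  ; erase-fill = id
  ; keys-fill  = λ M → f≗ (keys M)
  ; hangs-fill = λ M → g≗ (hangs M)
  ; cong-fill  = λ {_} {_} {n} p → seq (stay {n = 0}) p (m≤n+m n 2)
  ; close      = λ t h≤r _ → _ , _ , stay , t , m≤n⇒m≤1+n h≤r
  }

link-within : ∀ {m n r L k R} → AVL m L → AVL n R → m ≤ r → n ≤ r →
              ∃[ T ] ∃[ h ] (nd L k R ⇒[ 10 * suc r ] T) × AVL h T × h ≤ suc r
link-within {m} {n} {r} a b m≤r n≤r with link a b
... | linked {tree} {cost} {height} p t h≤ c≤ = tree , height ,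
  seq p (stay {n = 0}) (subst (_≤ 10 * suc r) (sym (+-identityʳ cost))
    (≤-trans (m+n≤o⇒m≤o cost c≤) (*-monoʳ-≤ 10 h≤1+r))) , t , h≤1+r
  where h≤1+r = h≤ (s≤s m≤r) (s≤s n≤r)

leftContext : ∀ {h q A a K C} → AVL h A → h ≤ q → keys A ++ a ∷ [] ≡ K → hangs A ≡ C →
              Context q (K ++_) (C ++_)
leftContext {A = A} {a} t h≤q eqK eqC = record
  { fill       = nd A a
  ; erase-fill = cong (node (erase A) a)
  ; keys-fill  = λ M → trans (sym (++-assoc (keys A) (a ∷ []) (keys M))) (cong (_++ keys M) eqK)
  ; hangs-fill = λ M → cong (_++ hangs M) eqC
  ; cong-fill  = inR
  ; close      = λ u u≤r q≤r → link-within t u (≤-trans h≤q q≤r) u≤r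
  }

rightContext : ∀ {h q A a K C} → AVL h A → h ≤ q → a ∷ keys A ≡ K → hangs A ≡ C →
               Context q (_++ K) (_++ C)
rightContext {A = A} {a} t h≤q eqK eqC = record
  { fill       = λ M → nd M a A
  ; erase-fill = cong (λ s → node s a (erase A))
  ; keys-fill  = λ M → cong (keys M ++_) eqK
  ; hangs-fill = λ M → cong (hangs M ++_) eqC
  ; cong-fill  = inL
  ; close      = λ u u≤r q≤r → link-within u t u≤r (≤-trans h≤q q≤r)
  }

record Exposed (h : ℕ) (T : Skel) (f : List ℕ → List ℕ) (g : List BT → List BT)
               (K : List ℕ) (C : List BT) : Set where
  constructor exposed
  field
    context : Context h f g
    {M}     : Skel
    {hᴹ}    : ℕ
    reach   : T ⇒[ 36 * h ] fill context M
    avl     : AVL hᴹ M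
    hᴹ≤h    : hᴹ ≤ h
    keys≡   : keys M ≡ K
    hangs≡  : hangs M ≡ C

splitAt-within : ∀ {h T i} → (s : Split h T i) → T ⇒[ 36 * h ] nd (Split.L s) (Split.x s) (Split.R s)
splitAt-within {h} (splitted {cost = c} {hˡ} {hʳ} p _ _ _ hˡ≤ hʳ≤ c≤) =
  seq p (stay {n = 0}) (begin
    c + 0                       ≡⟨ +-identityʳ c ⟩
    c                           ≤⟨ c≤ ⟩
    10 * (hˡ + hʳ) + 16 * h     ≤⟨ +-monoˡ-≤ (16 * h) (*-monoʳ-≤ 10 (+-mono-≤ hˡ≤ hʳ≤)) ⟩
    10 * (h + h) + 16 * h       ≡⟨ lem h ⟩
    36 * h                      ∎)
  where
    open ≤-Reasoning
    lem : ∀ h → 10 * (h + h) + 16 * h ≡ 36 * h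
    lem = solve-∀

-- The split is at the last key of `K₁`, which becomes the root and belongs to the context.
exposeSuffix : ∀ {h T} K₁ C₁ {K₂ C₂} → AVL h T → keys T ≡ K₁ ++ K₂ → hangs T ≡ C₁ ++ C₂ →
               length C₁ ≡ length K₁ → Exposed h T (K₁ ++_) (C₁ ++_) K₂ C₂
exposeSuffix [] [] t ks hs _ = exposed (trivial (λ _ → refl) (λ _ → refl)) stay t ≤-refl ks hs
exposeSuffix {h} {T} (k ∷ K) C₁ {K₂} t ks hs le
  with splitAt t (length K) (subst (length K <_)
         (sym (trans (cong length ks) (cong suc (length-++ K)))) (s≤s (m≤m+n _ _)))
... | s@(splitted {L} {R} {x} p sz l r hˡ≤ hʳ≤ _)
  with ++-injective (keys L ++ x ∷ []) (k ∷ K)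
         (trans (length-++ (keys L)) (trans (+-comm (size L) 1) (cong suc sz)))
         (trans (++-assoc (keys L) (x ∷ []) (keys R)) (trans (sym (keys-⇒ p)) ks))
     | ++-injective (hangs L) C₁ (trans (length-hangs L) (trans (cong suc sz) (sym le)))
         (trans (sym (hangs-⇒ p)) hs)
... | eqK , eqK₂ | eqC , eqC₂ = exposed
  (leftContext l hˡ≤ eqK eqC) (splitAt-within s) r hʳ≤ eqK₂ eqC₂

-- The split is at the first key of `K₃`. If `K₃` is empty, counting hanging trees shows that `C₃`
-- is empty too.
exposePrefix : ∀ {h T} K₂ C₂ {K₃ C₃} → AVL h T → keys T ≡ K₂ ++ K₃ → hangs T ≡ C₂ ++ C₃ →
               length C₂ ≡ suc (length K₂) → Exposed h T (_++ K₃) (_++ C₃) K₂ C₂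
exposePrefix {h} {T} K₂ C₂ {[]} {C₃} t ks hs le with length-0 C₃ C₃-empty
  where
    length-0 : ∀ {A : Set} (xs : List A) → length xs ≡ 0 → xs ≡ []
    length-0 [] _ = refl
    C₃-empty : length C₃ ≡ 0
    C₃-empty = +-cancelˡ-≡ (length C₂) _ _ (begin
      length C₂ + length C₃   ≡⟨ sym (length-++ C₂) ⟩
      length (C₂ ++ C₃)       ≡⟨ cong length (sym hs) ⟩
      length (hangs T)        ≡⟨ length-hangs T ⟩
      suc (size T)            ≡⟨ cong (λ z → suc (length z)) (trans ks (++-identityʳ K₂)) ⟩
      suc (length K₂)         ≡⟨ sym le ⟩
      length C₂               ≡⟨ sym (+-identityʳ _) ⟩
      length C₂ + 0           ∎)
      where open ≡-Reasoning
... | refl = exposed (trivial (λ K → sym (++-identityʳ K)) (λ C → sym (++-identityʳ C)))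
               stay t ≤-refl (trans ks (++-identityʳ K₂)) (trans hs (++-identityʳ C₂))
exposePrefix {h} {T} K₂ C₂ {k ∷ K} {C₃} t ks hs le
  with splitAt t (length K₂) (subst (length K₂ <_) (sym (trans (cong length ks) (length-++ K₂)))
                               (m<m+n (length K₂) z<s))
... | s@(splitted {L} {R} {x} p sz l r hˡ≤ hʳ≤ _)
  with ++-injective (keys L) K₂ sz (trans (sym (keys-⇒ p)) ks)
     | ++-injective (hangs L) C₂ (trans (length-hangs L) (trans (cong suc sz) (sym le)))
         (trans (sym (hangs-⇒ p)) hs)
... | eqK₂ , eqK | eqC₂ , eqC = exposed (rightContext r hʳ≤ eqK eqC) (splitAt-within s) l hˡ≤ eqK₂ eqC₂

opaque
  -- Two exposures at 36 and two links at 10 per level give 92. The 34 is the outer context entered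
  -- and left twice (4) plus the slack of the links (10 and 20).
  regroup-cost : ℕ → ℕ
  regroup-cost q = 92 * q + 34

  regroup-cost≡ : ∀ q → 92 * q + 34 ≡ regroup-cost q
  regroup-cost≡ _ = refl

-- Once the keys K₂ are exposed as a subtree M, that subtree may be read as any M′ with the
-- same underlying BST before it is merged with its surroundings again.  Reading an atomic
-- M as a node expands a child, reading a node M as atomic extracts one.
record Regrouped (q : ℕ) (T : Skel) (K₁ K₂ K₃ : List ℕ) (C₁ C₂ C₃ : List BT) : Set where
  field
    {M}       : Skel
    {hᴹ}      : ℕ
    avl       : AVL hᴹ M
    keys≡     : keys M ≡ K₂
    hangs≡    : hangs M ≡ C₂
    reattach  : ∀ {h M′} → AVL h M′ → h ≤ q → erase M ≡ erase M′ →
                ∃[ T′ ] ∃[ h′ ] AVL h′ T′ × keys T′ ≡ K₁ ++ keys M′ ++ K₃ ×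
                  hangs T′ ≡ C₁ ++ hangs M′ ++ C₃ × Local (erase T) (erase T′) (regroup-cost q)

regroup : ∀ {q h T} K₁ K₂ {K₃} C₁ C₂ {C₃} → AVL h T → h ≤ q →
          keys T ≡ K₁ ++ K₂ ++ K₃ → hangs T ≡ C₁ ++ C₂ ++ C₃ →
          length C₁ ≡ length K₁ → length C₂ ≡ suc (length K₂) → Regrouped q T K₁ K₂ K₃ C₁ C₂ C₃
regroup {q} {h} {T} K₁ K₂ {K₃} C₁ C₂ {C₃} t h≤q ks hs le₁ le₂
  with exposeSuffix K₁ C₁ t ks hs le₁
... | exposed W {N} {hᴺ} T⇒ avlᴺ hᴺ≤h ksᴺ hsᴺ with exposePrefix K₂ C₂ avlᴺ ksᴺ hsᴺ le₂
...   | exposed V {M} N⇒ avlᴹ hᴹ≤hᴺ ksᴹ hsᴹ = record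
  { avl = avlᴹ ; keys≡ = ksᴹ ; hangs≡ = hsᴹ ; reattach = reattach }
  where
    hᴺ≤q = ≤-trans hᴺ≤h h≤q
    total : 36 * h + (2 + 36 * hᴺ) + (2 + 10 * suc q + 10 * suc (suc q)) ≤ regroup-cost q
    total = begin
      36 * h + (2 + 36 * hᴺ) + (2 + 10 * suc q + 10 * suc (suc q))
        ≤⟨ +-monoˡ-≤ _ (+-mono-≤ (*-monoʳ-≤ 36 h≤q) (+-monoʳ-≤ 2 (*-monoʳ-≤ 36 hᴺ≤q))) ⟩
      36 * q + (2 + 36 * q) + (2 + 10 * suc q + 10 * suc (suc q))
        ≡⟨ lem q ⟩
      92 * q + 34
        ≡⟨ regroup-cost≡ q ⟩
      regroup-cost q ∎
      where
        open ≤-Reasoning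
        lem : ∀ q → 36 * q + (2 + 36 * q) + (2 + 10 * suc q + 10 * suc (suc q)) ≡ 92 * q + 34
        lem = solve-∀
    reattach : ∀ {h M′} → AVL h M′ → h ≤ q → erase M ≡ erase M′ →
               ∃[ T′ ] ∃[ h′ ] AVL h′ T′ × keys T′ ≡ K₁ ++ keys M′ ++ K₃ ×
                 hangs T′ ≡ C₁ ++ hangs M′ ++ C₃ × Local (erase T) (erase T′) (regroup-cost q)
    reattach {M′ = M′} m h′≤q eq with close V m h′≤q hᴺ≤q
    -- The first link may raise the height to `q + 1`, so the second one works with that bound.
    ... | N′ , _ , VM′⇒ , n , n≤ with close W n n≤ (≤-trans h≤q (n≤1+n q))
    ...   | T′ , _ , WN′⇒ , t′ , _ =
      T′ , _ , t′ ,
      trans (sym (keys-⇒ back)) (trans (keys-fill W _) (cong (K₁ ++_) (keys-fill V M′))) ,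
      trans (sym (hangs-⇒ back)) (trans (hangs-fill W _) (cong (C₁ ++_) (hangs-fill V M′))) ,
      -- The pointer sees only the underlying BST, so passing from `M` to `M′` between the two runs
      -- is free.
      λ fs → loosen total (subst (λ s → Steps _ (s , fs) _) (erase-fill W (erase-fill V eq))
                             (run (T⇒ then cong-fill W N⇒) fs) ⊕ run back fs)
      where back = cong-fill W VM′⇒ then WN′⇒

-- Paths inside a skeleton

rebuild-++ : ∀ t bs cs → BST.rebuild t (bs ++ cs) ≡ BST.rebuild (BST.rebuild t bs) cs
rebuild-++ t []       cs = refl
rebuild-++ t (b ∷ bs) cs = rebuild-++ (bplug b t) bs cs

ascend : ∀ {t fs} bs → Steps (t , bs ++ fs) (BST.rebuild t bs , fs) (length bs)
ascend []       = halt
ascend (b ∷ bs) = step up (ascend bs)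

data NonLeaf : BT → Set where
  nonLeaf : ∀ {l k r} → NonLeaf (node l k r)

descend : ∀ {t fs} bs → NonLeaf t → Steps (BST.rebuild t bs , fs) (t , bs ++ fs) (length bs)
descend []                nl = halt
descend {t} {fs} (b ∷ bs) nl =
  loosen (≤-reflexive (+-comm (length bs) 1)) (descend bs (plugged b) ⊕ last b nl)
  where
    plugged : ∀ b → NonLeaf (bplug b t)
    plugged (wentL _ _) = nonLeaf
    plugged (wentR _ _) = nonLeaf
    last : ∀ {fs} b → NonLeaf t → Steps (bplug b t , fs) (t , b ∷ fs) 1
    last (wentL _ _) nonLeaf = step downL halt
    last (wentR _ _) nonLeaf = step downR halt

trace : ∀ {c d n} → Steps c d n → ∃[ cs ] BST.Trace c d (c ∷ cs) × length cs ≤ n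
trace halt        = [] , BST.one _ , z≤n
trace (step st p) with trace p
... | _ , tr , le = _ , BST.cons st tr , s≤s le

touchingTrace : ∀ {x c e d m n} → Steps c e m → BSTTouches x (proj₁ e) → Steps e d n →
                ∃[ cs ] BST.Trace c d cs × Any (λ c → BSTTouches x (proj₁ c)) cs × length cs ≤ suc (m + n)
touchingTrace {m = m} halt t q with trace q
... | _ , tr , le = _ , tr , here t , s≤s (≤-trans le (m≤n+m _ m))
touchingTrace (step st p) t q with touchingTrace p t q
... | _ , tr , x∈ , le = _ , BST.cons st tr , there x∈ , s≤s le

length-∷ʳ-≤ : ∀ {A : Set} {m h} {x : A} xs → length xs ≤ m → m < h → length (xs ++ x ∷ []) ≤ h
length-∷ʳ-≤ xs p q = ≤-trans (≤-reflexive (trans (length-++ xs) (+-comm _ 1))) (≤-trans (s≤s p) q)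

∈-keys-path : ∀ {x} T → x ∈ keys T → ∃[ bs ] ∃[ l ] ∃[ r ]
              erase T ≡ BST.rebuild (node l x r) bs × (∀ {h} → AVL h T → length bs ≤ h)
∈-keys-path (nd l k r) x∈ with ∈-++⁻ (keys l) x∈
... | inj₂ (here refl) = [] , _ , _ , refl , λ _ → z≤n
... | inj₁ x∈l with ∈-keys-path l x∈l
...   | bs , a , b , eq , le = bs ++ wentL k (erase r) ∷ [] , a , b ,
        trans (cong (λ s → node s k (erase r)) eq) (sym (rebuild-++ _ bs _)) ,
        λ t → length-∷ʳ-≤ bs (le (Subtrees.avlˡ (children t))) (Subtrees.m<h (children t))
∈-keys-path (nd l k r) x∈ | inj₂ (there x∈r) with ∈-keys-path r x∈r
...   | bs , a , b , eq , le = bs ++ wentR (erase l) k ∷ [] , a , b ,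
        trans (cong (node (erase l) k) eq) (sym (rebuild-++ _ bs _)) ,
        λ t → length-∷ʳ-≤ bs (le (Subtrees.avlʳ (children t))) (Subtrees.n<h (children t))

++-locate : ∀ {A : Set} (as : List A) {bs} xs {y ys} → as ++ bs ≡ xs ++ y ∷ ys →
            (∃[ zs ] as ≡ xs ++ y ∷ zs × ys ≡ zs ++ bs) ⊎ (∃[ zs ] xs ≡ as ++ zs × bs ≡ zs ++ y ∷ ys)
++-locate []       xs       eq = inj₂ (xs , refl , eq)
++-locate (a ∷ as) []       refl = inj₁ (as , refl , refl)
++-locate (a ∷ as) (x ∷ xs) eq with ∷-injective eq
... | refl , eq′ with ++-locate as xs eq′
...   | inj₁ (zs , p , q) = inj₁ (zs , cong (a ∷_) p , q)
...   | inj₂ (zs , p , q) = inj₂ (zs , cong (a ∷_) p , q)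

-- Everything holds for an arbitrary `u`, since the subtree under the pointer is altered while the
-- surrounding piece stays fixed.
record Hole (T : Skel) (lts : List BT) (t : BT) (rts : List BT) : Set where
  field
    fillHole : BT → Skel
    path     : List BFrame
    avl      : ∀ u {h} → AVL h T → AVL h (fillHole u)
    keys≡    : ∀ u → keys (fillHole u) ≡ keys T
    hangs≡   : ∀ u → hangs (fillHole u) ≡ lts ++ u ∷ rts
    erase≡   : ∀ u → erase (fillHole u) ≡ BST.rebuild u path
    filled≡  : fillHole t ≡ T
    depth    : ∀ {h} → AVL h T → length path ≤ h

replaceˡ : ∀ {h l l′ k r} → (∀ {m} → AVL m l → AVL m l′) → AVL h (nd l k r) → AVL h (nd l′ k r)
replaceˡ f (even a b)  = even (f a) b
replaceˡ f (left a b)  = left (f a) b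
replaceˡ f (right a b) = right (f a) b

replaceʳ : ∀ {h l k r r′} → (∀ {m} → AVL m r → AVL m r′) → AVL h (nd l k r) → AVL h (nd l k r′)
replaceʳ f (even a b)  = even a (f b)
replaceʳ f (left a b)  = left a (f b)
replaceʳ f (right a b) = right a (f b)

hole : ∀ T lts {t rts} → hangs T ≡ lts ++ t ∷ rts → Hole T lts t rts
hole (hang t) [] refl = record
  { fillHole = hang ; path = [] ; avl = λ { _ hang → hang } ; keys≡ = λ _ → refl
  ; hangs≡ = λ _ → refl ; erase≡ = λ _ → refl ; filled≡ = refl ; depth = λ _ → z≤n }
hole (hang t) (_ ∷ []) ()
hole (hang t) (_ ∷ _ ∷ _) ()
hole (nd l k r) lts eq with ++-locate (hangs l) lts eq
... | inj₁ (zs , p , refl) = record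
  { fillHole = λ u → nd (fillHole u) k r
  ; path     = path ++ wentL k (erase r) ∷ []
  ; avl      = λ u → replaceˡ (avl u)
  ; keys≡    = λ u → cong (_++ k ∷ keys r) (keys≡ u)
  ; hangs≡   = λ u → trans (cong (_++ hangs r) (hangs≡ u)) (++-assoc lts (u ∷ zs) (hangs r))
  ; erase≡   = λ u → trans (cong (λ s → node s k (erase r)) (erase≡ u)) (sym (rebuild-++ u path _))
  ; filled≡  = cong (λ l → nd l k r) filled≡
  ; depth    = λ t → length-∷ʳ-≤ path (depth (Subtrees.avlˡ (children t))) (Subtrees.m<h (children t))
  }
  where open Hole (hole l lts p)
... | inj₂ (zs , refl , q) = record
  { fillHole = λ u → nd l k (fillHole u)
  ; path     = path ++ wentR (erase l) k ∷ []
  ; avl      = λ u → replaceʳ (avl u)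
  ; keys≡    = λ u → cong (λ ks → keys l ++ k ∷ ks) (keys≡ u)
  ; hangs≡   = λ u → trans (cong (hangs l ++_) (hangs≡ u)) (sym (++-assoc (hangs l) zs _))
  ; erase≡   = λ u → trans (cong (node (erase l) k) (erase≡ u)) (sym (rebuild-++ u path _))
  ; filled≡  = cong (nd l k) filled≡
  ; depth    = λ t → length-∷ʳ-≤ path (depth (Subtrees.avlʳ (children t))) (Subtrees.n<h (children t))
  }
  where open Hole (hole r zs q)

Pointwise-++⁻ : ∀ {A B : Set} {R : A → B → Set} xs {ys zs} → Pointwise R (xs ++ ys) zs →
                ∃[ zs₁ ] ∃[ zs₂ ] zs ≡ zs₁ ++ zs₂ × Pointwise R xs zs₁ × Pointwise R ys zs₂
Pointwise-++⁻ []       ps       = [] , _ , refl , [] , ps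
Pointwise-++⁻ (x ∷ xs) (p ∷ ps) with Pointwise-++⁻ xs ps
... | _ , _ , refl , qs , rs = _ , _ , refl , p ∷ qs , rs

length-insert : ∀ {A : Set} (as bs cs : List A) → length (as ++ bs ++ cs) ≡ length bs + length (as ++ cs)
length-insert as bs cs = begin
  length (as ++ bs ++ cs)            ≡⟨ length-++ as ⟩
  length as + length (bs ++ cs)      ≡⟨ cong (length as +_) (length-++ bs) ⟩
  length as + (length bs + length cs) ≡⟨ lem (length as) (length bs) (length cs) ⟩
  length bs + (length as + length cs) ≡⟨ cong (length bs +_) (sym (length-++ as)) ⟩
  length bs + length (as ++ cs)      ∎
  where
    open ≡-Reasoning
    lem : ∀ a b c → a + (b + c) ≡ b + (a + c)
    lem = solve-∀

-- Representing B-trees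

-- The BST s consists of a balanced tree on ks whose i-th hanging tree is related to the i-th child.
record Body (_~_ : BTree → BT → Set) (ks : List ℕ) (cs : List BTree) (s : BT) : Set where
  constructor body
  field
    {T}    : Skel
    {h}    : ℕ
    avl    : AVL h T
    keys≡  : keys T ≡ ks
    below  : Pointwise _~_ cs (hangs T)
    erase≡ : erase T ≡ s

data Rep (B : ℕ) : BTree → BT → Set where
  nil  : Rep B nil leaf
  node : ∀ {ks cs s} → 1 ≤ length ks → length ks < B → Body (Rep B) ks cs s → Rep B (node ks cs) s

module _ {_~_ : BTree → BT → Set} where

  recast : ∀ {ks ks′ cs cs′ s} → ks ≡ ks′ → cs ≡ cs′ → Body _~_ ks cs s → Body _~_ ks′ cs′ s
  recast refl refl b = b

  body-length : ∀ {ks cs s} → Body _~_ ks cs s → length cs ≡ suc (length ks)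
  body-length (body {T} _ refl ps _) = trans (Pointwise-length ps) (length-hangs T)

  body-nonLeaf : ∀ {ks cs s} → Body _~_ ks cs s → 1 ≤ length ks → NonLeaf s
  body-nonLeaf (body {nd _ _ _} _ refl _ refl) _ = nonLeaf

-- Identifies what an isolated empty interval is, namely the hanging child itself; it also treats a
-- parent that has lost its last key.
keys≡[] : ∀ T {t} → keys T ≡ [] → hangs T ≡ t ∷ [] → erase T ≡ t
keys≡[] (hang _) _ refl = refl
keys≡[] (nd l _ _) eq _ with keys l | eq
... | []    | ()
... | _ ∷ _ | ()

rep-nonLeaf : ∀ {B c s} → Rep B c s → ¬ c ≡ nil → NonLeaf s
rep-nonLeaf nil          c≢nil = ⊥-elim (c≢nil refl)
rep-nonLeaf (node 1≤ _ b) _    = body-nonLeaf b 1≤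

-- In-order sequences and the initial tree

weave : List BT → List ℕ → List ℕ
weave []       ks       = ks
weave (t ∷ ts) []       = inorder t ++ weave ts []
weave (t ∷ ts) (k ∷ ks) = inorder t ++ k ∷ weave ts ks

weave-++ : ∀ ts ks {ts′ k ks′} → length ts ≡ suc (length ks) →
           weave (ts ++ ts′) (ks ++ k ∷ ks′) ≡ weave ts ks ++ k ∷ weave ts′ ks′
weave-++ (t ∷ [])     []       {ts′} {k} {ks′} _ = cong (_++ k ∷ weave ts′ ks′) (sym (++-identityʳ (inorder t)))
weave-++ (t ∷ u ∷ ts) (k ∷ ks) le = trans
  (cong (λ z → inorder t ++ k ∷ z) (weave-++ (u ∷ ts) ks (suc-injective le)))
  (sym (++-assoc (inorder t) (k ∷ weave (u ∷ ts) ks) _))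

inorder-erase : ∀ T → inorder (erase T) ≡ weave (hangs T) (keys T)
inorder-erase (hang t)   = sym (++-identityʳ (inorder t))
inorder-erase (nd l k r) = trans (cong₂ (λ x y → x ++ k ∷ y) (inorder-erase l) (inorder-erase r))
  (sym (weave-++ (hangs l) (keys l) (length-hangs l)))

mutual
  inorder-rep : ∀ {B t s} → Rep B t s → inorder s ≡ inorderB t
  inorder-rep nil = refl
  inorder-rep (node _ _ (body {T} _ refl ps refl)) = trans (inorder-erase T) (weave-reps (keys T) ps)

  weave-reps : ∀ {B cs ts} ks → Pointwise (Rep B) cs ts → weave ts ks ≡ interleave cs ks
  weave-reps ks       []       = refl
  weave-reps []       (p ∷ ps) = cong₂ _++_ (inorder-rep p) (weave-reps [] ps)
  weave-reps (k ∷ ks) (p ∷ ps) = cong₂ (λ x y → x ++ k ∷ y) (inorder-rep p) (weave-reps ks ps)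

-- The keys are added one by one at the left end by links. The rotations are not charged, since the
-- initial BST may be chosen freely.
balanced : ∀ ks ts → length ts ≡ suc (length ks) → ∃[ T ] ∃[ h ] AVL h T × keys T ≡ ks × hangs T ≡ ts
balanced []       (t ∷ []) _  = hang t , 0 , hang , refl , refl
balanced (k ∷ ks) (t ∷ ts) le with balanced ks ts (suc-injective le)
... | T , _ , a , refl , refl with link {L = hang t} {k} hang a
...   | linked p a′ _ _ = _ , _ , a′ , sym (keys-⇒ p) , sym (hangs-⇒ p)

≤∸1⇒< : ∀ {B n} → 2 ≤ B → n ≤ B ∸ 1 → n < B
≤∸1⇒< 2≤B n≤ = ≤-trans (s≤s n≤) (≤-reflexive (m+[n∸m]≡n (≤-trans (n≤1+n 1) 2≤B)))

mutual
  represent : ∀ {B t} → 2 ≤ B → WFB B t → ∃[ s ] Rep B t s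
  represent 2≤B nil = leaf , nil
  represent {B} 2≤B (node {ks} 1≤ ≤B∸1 le ws) with representAll 2≤B ws
  ... | ts , ps with balanced ks ts (trans (sym (Pointwise-length ps)) le)
  ...   | T , _ , a , ks≡ , hs≡ = erase T ,
    node 1≤ (≤∸1⇒< 2≤B ≤B∸1)
      (body a ks≡ (subst (Pointwise (Rep B) _) (sym hs≡) ps) refl)

  representAll : ∀ {B cs} → 2 ≤ B → All (WFB B) cs → ∃[ ts ] Pointwise (Rep B) cs ts
  representAll 2≤B []       = [] , []
  representAll 2≤B (w ∷ ws) with represent 2≤B w | representAll 2≤B ws
  ... | _ , p | _ , ps = _ , p ∷ ps

-- Simulation

module Simulation (B Q : ℕ) (2≤B : 2 ≤ B)
                  (height-bound : ∀ {h T} → AVL h T → size T < 4 * B → h ≤ Q) where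

  R stepCost : ℕ
  R        = regroup-cost Q
  -- A walk up to the root of the parent's piece, at most three regroupings, and a walk down.
  stepCost = Q + (R + (R + R)) + Q

  Body′ = Body (Rep B)

  height≤Q : ∀ {ks cs s} → (b : Body′ ks cs s) → length ks < 4 * B → Body.h b ≤ Q
  height≤Q (body {T} t refl _ _) ks< = height-bound t ks<

  <B⇒<4B : ∀ {n} → n < B → n < 4 * B
  <B⇒<4B n<B = <-≤-trans n<B (m≤m+n B _)

  Reshape : ℕ → BT → List ℕ → List BTree → Set
  Reshape n s ks cs = ∃[ s′ ] Local s s′ n × Body′ ks cs s′

  _>>=_ : ∀ {m n s ks cs ks′ cs′} → Reshape m s ks cs →
          (∀ {s′} → Body′ ks cs s′ → Reshape n s′ ks′ cs′) → Reshape (m + n) s ks′ cs′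
  (_ , p , b) >>= f with f b
  ... | _ , q , c = _ , (λ fs → p fs ⊕ q fs) , c

  -- Isolating the empty interval between `K₁` and `K₃` yields the hanging child; it is then reread
  -- as its own skeleton.
  expand : ∀ K₁ {us K₃} C₁ {ds C₃ s} → length C₁ ≡ length K₁ → length (K₁ ++ K₃) < 4 * B →
           Body′ (K₁ ++ K₃) (C₁ ++ node us ds ∷ C₃) s → Reshape R s (K₁ ++ us ++ K₃) (C₁ ++ ds ++ C₃)
  expand K₁ C₁ le lt b@(body {T} t ks ps refl) with hangs T in hs | Pointwise-++⁻ C₁ ps
  ... | _ | ts₁ , u ∷ ts₃ , refl , ps₁ , node _ us<B bᵘ@(body {U} tᵘ refl psᵘ refl) ∷ ps₃
    with regroup K₁ [] ts₁ (u ∷ []) t (height≤Q b lt) ks hs (trans (sym (Pointwise-length ps₁)) le) refl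
  ... | rg with Regrouped.reattach rg tᵘ (height≤Q bᵘ (<B⇒<4B us<B))
                  (keys≡[] (Regrouped.M rg) (Regrouped.keys≡ rg) (Regrouped.hangs≡ rg))
  ...   | T′ , _ , t′ , ks′ , hs′ , run′ = _ , run′ ,
          body t′ ks′ (subst (Pointwise (Rep B) _) (sym hs′) (++⁺ ps₁ (++⁺ psᵘ ps₃))) refl

  -- The isolated interval is reread as a single `hang`, and its old skeleton becomes the body of
  -- the new child.
  extract : ∀ K₁ K₂ {K₃} C₁ C₂ {C₃ s} → length C₁ ≡ length K₁ → length C₂ ≡ suc (length K₂) →
            length (K₁ ++ K₂ ++ K₃) < 4 * B → 1 ≤ length K₂ → length K₂ < B →
            Body′ (K₁ ++ K₂ ++ K₃) (C₁ ++ C₂ ++ C₃) s → Reshape R s (K₁ ++ K₃) (C₁ ++ node K₂ C₂ ∷ C₃)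
  extract K₁ K₂ C₁ C₂ le₁ le₂ lt 1≤ <B b@(body {T} t ks ps refl) with hangs T in hs | Pointwise-++⁻ C₁ ps
  ... | _ | ts₁ , _ , refl , ps₁ , ps₂₃ with Pointwise-++⁻ C₂ ps₂₃
  ...   | ts₂ , ts₃ , refl , ps₂ , ps₃
    with regroup K₁ K₂ ts₁ ts₂ t (height≤Q b lt) ks hs (trans (sym (Pointwise-length ps₁)) le₁)
           (trans (sym (Pointwise-length ps₂)) le₂)
  ... | rg with Regrouped.reattach rg {M′ = hang (erase (Regrouped.M rg))} hang z≤n refl
  ...   | T′ , _ , t′ , ks′ , hs′ , run′ = _ , run′ ,
          body t′ ks′ (subst (Pointwise (Rep B) _) (sym hs′) (++⁺ ps₁ (child ∷ ps₃))) refl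
    where
      child = node 1≤ <B (body (Regrouped.avl rg) (Regrouped.keys≡ rg)
                (subst (Pointwise (Rep B) _) (sym (Regrouped.hangs≡ rg)) ps₂) refl)

  -- One B-tree frame corresponds to a whole path `bs` of BST frames through the parent's piece.
  record FrameRep (lk : List ℕ) (lc : List BTree) (rk : List ℕ) (rc : List BTree)
                  (bs : List BFrame) : Set where
    field
      {lts rts} : List BT
      {h}       : ℕ
      skel      : BT → Skel
      avl       : ∀ u → AVL h (skel u)
      keys≡     : ∀ u → keys (skel u) ≡ lk ++ rk
      hangs≡    : ∀ u → hangs (skel u) ≡ lts ++ u ∷ rts
      erase≡    : ∀ u → erase (skel u) ≡ BST.rebuild u bs
      lefts     : Pointwise (Rep B) lc lts
      rights    : Pointwise (Rep B) rc rts
      aligned   : length lc ≡ length lk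
      nonempty  : 1 ≤ length (lk ++ rk)
      bounded   : length (lk ++ rk) < B
      depth     : length bs ≤ Q

  data StackRep : List BTFrame → List BFrame → Set where
    []  : StackRep [] []
    _∷_ : ∀ {lk lc rk rc bs fs bs′} → FrameRep lk lc rk rc bs → StackRep fs bs′ →
          StackRep (frame lk lc rk rc ∷ fs) (bs ++ bs′)

  ConfigRep : BTM.Config B → BST.Config → Set
  ConfigRep (t , fs) (s , bs) = Rep B t s × StackRep fs bs

  plug-body : ∀ {lk lc rk rc bs t s} → FrameRep lk lc rk rc bs → Rep B t s →
              Body′ (lk ++ rk) (lc ++ t ∷ rc) (BST.rebuild s bs)
  plug-body {s = s} f r = body (avl s) (keys≡ s)
    (subst (Pointwise (Rep B) _) (sym (hangs≡ s)) (++⁺ lefts (r ∷ rights))) (erase≡ s)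
    where open FrameRep f

  plug-rep : ∀ {lk lc rk rc bs t s} → FrameRep lk lc rk rc bs → Rep B t s →
             Rep B (btplug (frame lk lc rk rc) t) (BST.rebuild s bs)
  plug-rep f r = node (FrameRep.nonempty f) (FrameRep.bounded f) (plug-body f r)

  treeOf-rep : ∀ {t fs s bs} → Rep B t s → StackRep fs bs → Rep B (BTM.treeOf B (t , fs)) (BST.treeOf (s , bs))
  treeOf-rep r []                              = r
  treeOf-rep {s = s} r (_∷_ {bs = bs} f fs) =
    subst (Rep B _) (sym (rebuild-++ s bs _)) (treeOf-rep (plug-rep f r) fs)

  focus : ∀ {lk rk c rc s} lc → length lc ≡ length lk → 1 ≤ length (lk ++ rk) → length (lk ++ rk) < B →
          Body′ (lk ++ rk) (lc ++ c ∷ rc) s →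
          ∃[ t ] ∃[ bs ] s ≡ BST.rebuild t bs × Rep B c t × FrameRep lk lc rk rc bs
  focus lc le 1≤ <B b@(body {T} t ks ps refl) with hangs T in hs | Pointwise-++⁻ lc ps
  ... | _ | ts₁ , u ∷ ts₃ , refl , ps₁ , p ∷ ps₃ =
    u , path , trans (cong erase (sym filled≡)) (erase≡ u) , p , record
      { skel = fillHole ; avl = λ u → avl u t ; keys≡ = λ u → trans (keys≡ u) ks ; hangs≡ = hangs≡
      ; erase≡ = erase≡ ; lefts = ps₁ ; rights = ps₃ ; aligned = le ; nonempty = 1≤ ; bounded = <B
      ; depth = ≤-trans (depth t) (height≤Q b (<B⇒<4B <B)) }
    where open Hole (hole T ts₁ hs)

  descend-into : ∀ {lk rk c rc s fs bs} lc → length lc ≡ length lk → 1 ≤ length (lk ++ rk) →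
                 length (lk ++ rk) < B → ¬ c ≡ nil → Body′ (lk ++ rk) (lc ++ c ∷ rc) s → StackRep fs bs →
                 ∃[ d ] Steps (s , bs) d Q × ConfigRep (c , frame lk lc rk rc ∷ fs) d
  descend-into lc le 1≤ <B c≢nil b fr with focus lc le 1≤ <B b
  ... | t , path , refl , r , f =
    _ , loosen (FrameRep.depth f) (descend path (rep-nonLeaf r c≢nil)) , r , f ∷ fr

  -- Removing an emptied parent is free: a piece without keys is the same BST as its only child.
  parent-rep : ∀ ks cs {s} → length ks < B → Body′ ks cs s → Rep B (mkParent ks cs) s
  parent-rep (k ∷ ks) cs <B b = node (s≤s z≤n) <B b
  parent-rep [] cs <B b with cs | body-length b | b
  ... | c ∷ [] | _ | body {T} t ks ps refl with hangs T in hs | ps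
  ...   | _ | p ∷ [] = subst (Rep B c) (sym (keys≡[] T ks hs)) p

  -- Extracting `ul` and then `ur` leaves `um` behind in the parent's piece.
  splitBody : ∀ lk lc ul um {ur rk} dl dr {rc s} → length lc ≡ length lk →
              length dl ≡ suc (length ul) → length dr ≡ suc (length ur) → 1 ≤ length ul → 1 ≤ length ur →
              length (ul ++ um ∷ ur) < B → length (lk ++ (ul ++ um ∷ ur) ++ rk) < 4 * B →
              Body′ (lk ++ (ul ++ um ∷ ur) ++ rk) (lc ++ (dl ++ dr) ++ rc) s →
              Reshape (R + R) s (lk ++ um ∷ rk) (lc ++ node ul dl ∷ node ur dr ∷ rc)
  splitBody lk lc ul um {ur} {rk} dl dr {rc} le leˡ leʳ 1≤ul 1≤ur us<B lt b =
    extract lk ul lc dl le leˡ lt₁ 1≤ul ul<B (recast eq₁ (cong (lc ++_) (++-assoc dl dr rc)) b) >>= λ b′ →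
    reassociate (extract (lk ++ um ∷ []) ur (lc ++ node ul dl ∷ []) dr le₂ leʳ lt₂ 1≤ur ur<B
      (recast (sym (++-assoc lk (um ∷ []) (ur ++ rk))) (sym (++-assoc lc (node ul dl ∷ []) (dr ++ rc))) b′))
    where
      reassociate : ∀ {n s} → Reshape n s ((lk ++ um ∷ []) ++ rk) ((lc ++ node ul dl ∷ []) ++ node ur dr ∷ rc) →
                    Reshape n s (lk ++ um ∷ rk) (lc ++ node ul dl ∷ node ur dr ∷ rc)
      reassociate (_ , p , b) = _ , p , recast (++-assoc lk (um ∷ []) rk) (++-assoc lc (node ul dl ∷ []) _) b
      eq₁ : lk ++ (ul ++ um ∷ ur) ++ rk ≡ lk ++ ul ++ um ∷ ur ++ rk
      eq₁ = cong (lk ++_) (++-assoc ul (um ∷ ur) rk)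
      lt₁ : length (lk ++ ul ++ um ∷ ur ++ rk) < 4 * B
      lt₁ = subst (λ l → length l < 4 * B) eq₁ lt
      lt₂ : length ((lk ++ um ∷ []) ++ ur ++ rk) < 4 * B
      lt₂ = ≤-<-trans (m≤n+m _ (length ul)) (subst (_< 4 * B)
              (trans (length-insert lk ul (um ∷ ur ++ rk))
                     (cong (λ l → length ul + length l) (sym (++-assoc lk (um ∷ []) (ur ++ rk))))) lt₁)
      le₂ : length (lc ++ node ul dl ∷ []) ≡ length (lk ++ um ∷ [])
      le₂ = trans (length-++ lc) (trans (cong (_+ 1) le) (sym (length-++ lk)))
      ul<B : length ul < B
      ul<B = ≤-<-trans (m≤m+n _ _) (subst (_< B) (length-++ ul) us<B)
      ur<B : length ur < B
      ur<B = ≤-<-trans (≤-trans (n≤1+n _) (m≤n+m _ (length ul))) (subst (_< B) (length-++ ul) us<B)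

  sum<4B : ∀ {m n} → m < B → n < B → m + n < 4 * B
  sum<4B m<B n<B = <-≤-trans (+-mono-< m<B n<B) (+-monoʳ-≤ B (m≤m+n B _))

  insert<4B : ∀ {as bs cs : List ℕ} → length bs < B → length (as ++ cs) < B → length (as ++ bs ++ cs) < 4 * B
  insert<4B {as} {bs} {cs} p q = subst (_< 4 * B) (sym (length-insert as bs cs)) (sum<4B p q)

  node-length : ∀ {ks cs s} → Rep B (node ks cs) s → length cs ≡ suc (length ks) × length ks < B
  node-length (node _ <B b) = body-length b , <B

  child-length : ∀ {ks us ds C₃ s} C₁ → Body′ ks (C₁ ++ node us ds ∷ C₃) s →
                 length ds ≡ suc (length us) × length us < B
  child-length C₁ (body _ _ ps _) with Pointwise-++⁻ C₁ ps
  ... | _ , _ ∷ _ , _ , _ , r ∷ _ = node-length r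

  suffix-length : ∀ (ul : List ℕ) um ur (dl dr : List BTree) → length dl ≡ suc (length ul) →
                  length (dl ++ dr) ≡ suc (length (ul ++ um ∷ ur)) → length dr ≡ suc (length ur)
  suffix-length ul um ur dl dr leˡ le = +-cancelˡ-≡ (length dl) _ _ (begin
    length dl + length dr                ≡⟨ sym (length-++ dl) ⟩
    length (dl ++ dr)                    ≡⟨ le ⟩
    suc (length (ul ++ um ∷ ur))         ≡⟨ cong suc (length-++ ul) ⟩
    suc (length ul) + suc (length ur)    ≡⟨ cong (_+ suc (length ur)) (sym leˡ) ⟩
    length dl + suc (length ur)          ∎)
    where open ≡-Reasoning

  -- Both siblings are absorbed into the parent's piece, and then `us`, `k` and `vs` are extracted
  -- as one child.
  joinBody : ∀ kl {k kr us ds vs es cr s} cl → length cl ≡ length kl → length (kl ++ k ∷ kr) < B →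
             length us + length vs ≤ B ∸ 2 → Body′ (kl ++ k ∷ kr) (cl ++ node us ds ∷ node vs es ∷ cr) s →
             Reshape (R + (R + R)) s (kl ++ kr) (cl ++ node (us ++ k ∷ vs) (ds ++ es) ∷ cr)
  joinBody kl {k} {kr} {us} {ds} {vs} {es} {cr} cl le ks<B uv≤ b =
    expand kl cl le (<B⇒<4B ks<B) b >>= λ b₁ →
    expand (kl ++ us ++ k ∷ []) (cl ++ ds) le₁ lt₁
      (recast (sym (assoc kr)) (sym (++-assoc cl ds _)) b₁) >>= λ b₂ →
    extract kl (us ++ k ∷ vs) cl (ds ++ es) le le₂ lt₂ 1≤ new<B
      (recast eq₂ (trans (++-assoc cl ds _) (cong (cl ++_) (sym (++-assoc ds es cr)))) b₂)
    where
      lenᵘ = child-length cl b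
      lenᵛ = child-length (cl ++ node us ds ∷ []) (recast refl (sym (++-assoc cl (node us ds ∷ []) _)) b)
      assoc : ∀ rest → (kl ++ us ++ k ∷ []) ++ rest ≡ kl ++ us ++ k ∷ rest
      assoc rest = trans (++-assoc kl (us ++ k ∷ []) rest) (cong (kl ++_) (++-assoc us (k ∷ []) rest))
      eq₂ : (kl ++ us ++ k ∷ []) ++ vs ++ kr ≡ kl ++ (us ++ k ∷ vs) ++ kr
      eq₂ = trans (assoc (vs ++ kr)) (cong (kl ++_) (sym (++-assoc us (k ∷ vs) kr)))
      le₁ : length (cl ++ ds) ≡ length (kl ++ us ++ k ∷ [])
      le₁ = begin
        length (cl ++ ds)                  ≡⟨ length-++ cl ⟩
        length cl + length ds              ≡⟨ cong₂ _+_ le (trans (proj₁ lenᵘ) (+-comm 1 _)) ⟩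
        length kl + (length us + 1)        ≡⟨ cong (length kl +_) (sym (length-++ us)) ⟩
        length kl + length (us ++ k ∷ [])  ≡⟨ sym (length-++ kl) ⟩
        length (kl ++ us ++ k ∷ [])        ∎
        where open ≡-Reasoning
      le₂ : length (ds ++ es) ≡ suc (length (us ++ k ∷ vs))
      le₂ = trans (length-++ ds) (trans (cong₂ _+_ (proj₁ lenᵘ) (proj₁ lenᵛ)) (cong suc (sym (length-++ us))))
      lt₁ : length ((kl ++ us ++ k ∷ []) ++ kr) < 4 * B
      lt₁ = subst (λ l → length l < 4 * B) (sym (assoc kr)) (insert<4B {kl} {us} (proj₂ lenᵘ) ks<B)
      1≤ : 1 ≤ length (us ++ k ∷ vs)
      1≤ = subst (1 ≤_) (sym (trans (length-++ us) (+-suc (length us) (length vs)))) (s≤s z≤n)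
      new<B : length (us ++ k ∷ vs) < B
      new<B = subst (_< B) (sym (trans (length-++ us) (+-suc (length us) (length vs))))
        (≤-trans (s≤s (s≤s uv≤)) (≤-reflexive (m+[n∸m]≡n 2≤B)))
      lt₂ : length (kl ++ (us ++ k ∷ vs) ++ kr) < 4 * B
      lt₂ = insert<4B {kl} new<B (<-trans ≤-refl (subst (_< B) (length-insert kl (k ∷ []) kr) ks<B))

  -- Pointer moves become walks. A split or a rotation first walks to the parent and absorbs the
  -- current node; a rotation then extracts the new interval and walks down to it.
  simulate : ∀ {c d c′} → BTStep B c d → ConfigRep c c′ → ∃[ d′ ] Steps c′ d′ stepCost × ConfigRep d d′
  simulate up (r , _∷_ {bs = bs} f fs) = _ ,
    loosen (≤-trans (FrameRep.depth f) (≤-trans (m≤m+n Q _) (m≤m+n _ Q))) (ascend bs) , plug-rep f r , fs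
  simulate (down {lk = lk} {lc = lc} refl refl le c≢nil) (node 1≤ <B b , fs)
    with descend-into {lk} lc le 1≤ <B c≢nil b fs
  ... | d , st , cr = d , loosen (m≤n+m Q _) st , cr
  simulate (split {ul = ul} {um} {ur} {dl} {dr} {lk} {lc} {rk} {rc} refl 1≤ul 1≤ur refl leˡ full)
           (r@(node _ us<B b) , _∷_ {bs = bs} {bs′ = bs′} f fs)
    with expand lk lc aligned (<B⇒<4B bounded) (plug-body f r) >>=
         splitBody lk lc ul um dl dr aligned leˡ
           (suffix-length ul um ur dl dr leˡ (body-length b)) 1≤ul 1≤ur us<B (insert<4B {lk} us<B bounded)
    where open FrameRep f
  ... | _ , p , b′ = _ ,
    loosen (≤-trans (+-monoˡ-≤ _ (FrameRep.depth f)) (m≤m+n _ Q)) (ascend bs ⊕ p bs′) ,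
    node (subst (1 ≤_) (sym (length-insert lk (um ∷ []) rk)) (s≤s z≤n))
         (subst (_< B) (sym (length-insert lk (um ∷ []) rk)) (≤∸1⇒< 2≤B full)) b′ , fs
  simulate (splitRoot {ul = ul} {um} {ur} {dl} {dr} refl 1≤ul 1≤ur refl leˡ) (node 1≤ us<B b , [])
    -- The root piece itself plays the part of the parent that has already absorbed the node, with
    -- no keys around it.
    with splitBody [] [] ul um {rk = []} dl dr {rc = []} refl leˡ
           (suffix-length ul um ur dl dr leˡ (body-length b)) 1≤ul 1≤ur us<B
           (subst (λ l → length l < 4 * B) (sym (++-identityʳ (ul ++ um ∷ ur))) (<B⇒<4B us<B))
           (recast (sym (++-identityʳ _)) (sym (++-identityʳ _)) b)
  ... | _ , p , b′ = _ , loosen (≤-trans (≤-trans (m≤n+m _ R) (m≤n+m _ Q)) (m≤m+n _ Q)) (p []) ,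
    node (s≤s z≤n) 2≤B b′ , []
  simulate (join {kl = kl} {k} {kr} {cl} refl refl le uv≤) (node _ ks<B b , fs)
    with joinBody kl cl le ks<B uv≤ b
  ... | _ , p , b′ = _ , loosen (≤-trans (m≤n+m _ Q) (m≤m+n _ Q)) (p _) ,
    parent-rep (kl ++ kr) _ (<-trans ≤-refl (subst (_< B) (length-insert kl (k ∷ []) kr) ks<B)) b′ , fs
  simulate (rotate {us} {ds} {lk} {lc} {rk} {rc} {P1} {P2} {P3} {S1} {S2} {S3} eqP eqS le₁ le₂ 1≤P2 1≤P P2≤ P≤)
           (r@(node _ us<B _) , _∷_ {bs = bs} {bs′ = bs′} f fs)
    with expand lk lc aligned (<B⇒<4B bounded) (plug-body f r) >>= (λ b →
         extract P1 P2 S1 S2 le₁ le₂ (subst (λ l → length l < 4 * B) eqP (insert<4B {lk} us<B bounded))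
           1≤P2 (≤∸1⇒< 2≤B P2≤) (recast eqP eqS b))
    where open FrameRep f
  ... | _ , p , b′ with descend-into S1 le₁ 1≤P (≤∸1⇒< 2≤B P≤) (λ ()) b′ fs
  ...   | d , st , cr = d ,
    loosen (+-monoˡ-≤ Q (+-mono-≤ (FrameRep.depth f) (m≤n+m (R + R) R))) ((ascend bs ⊕ p bs′) ⊕ st) , cr

  -- Simulation of whole searches

  simulateTrace : ∀ {c d cs c′} → BTM.Trace B c d cs → ConfigRep c c′ →
                  ∃[ d′ ] Steps c′ d′ (length cs * stepCost) × ConfigRep d d′
  simulateTrace (BTM.one c)      r = _ , halt , r
  simulateTrace (BTM.cons st tr) r with simulate st r
  ... | _ , p , r₁ with simulateTrace tr r₁
  ...   | _ , q , r₂ = _ , p ⊕ q , r₂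

  record TouchingRun (x : ℕ) (d : BTM.Config B) (c′ : BST.Config) (n : ℕ) : Set where
    constructor touchingRun
    field
      {e′ d′}  : BST.Config
      {n₁ n₂}  : ℕ
      before   : Steps c′ e′ n₁
      touches  : BSTTouches x (proj₁ e′)
      after    : Steps e′ d′ n₂
      represents : ConfigRep d d′
      total    : n₁ + n₂ ≤ n

  -- The sought key may lie deep inside the piece, so the BST pointer makes a detour to it and
  -- returns. This happens once per search.
  touch : ∀ {x c c′} → ConfigRep c c′ → BTTouches x (proj₁ c) →
          ∃[ e ] Steps c′ e Q × BSTTouches x (proj₁ e) × Steps e c′ Q
  touch (node _ <B b@(body {T} t refl _ refl) , _) x∈ with ∈-keys-path T x∈
  ... | bs , l , r , eq , depth rewrite eq = _ ,
    loosen bs≤Q (descend bs nonLeaf) , refl , loosen bs≤Q (ascend bs)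
    where bs≤Q = ≤-trans (depth t) (height≤Q b (<B⇒<4B <B))

  simulateTouching : ∀ {x c d cs c′} → BTM.Trace B c d cs → Any (λ c → BTTouches x (proj₁ c)) cs →
                     ConfigRep c c′ → TouchingRun x d c′ (Q + Q + length cs * stepCost)
  simulateTouching (BTM.one c) (here x∈) r with touch r x∈
  ... | _ , p , t , q = touchingRun p t q r (m≤m+n (Q + Q) _)
  simulateTouching tr@(BTM.cons _ _) (here x∈) r with touch r x∈ | simulateTrace tr r
  ... | _ , p , t , q | _ , run′ , r′ = touchingRun p t (q ⊕ run′) r′ (≤-reflexive (sym (+-assoc Q Q _)))
  simulateTouching {cs = _ ∷ cs} (BTM.cons st tr) (there x∈) r with simulate st r
  ... | _ , p , r₁ with simulateTouching tr x∈ r₁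
  ...   | touchingRun {n₁ = n₁} {n₂} q t q′ r₂ le = touchingRun (p ⊕ q) t q′ r₂
    (begin
      stepCost + n₁ + n₂                              ≡⟨ +-assoc stepCost n₁ n₂ ⟩
      stepCost + (n₁ + n₂)                            ≤⟨ +-monoʳ-≤ stepCost le ⟩
      stepCost + (Q + Q + length cs * stepCost)       ≡⟨ lem stepCost (Q + Q) (length cs * stepCost) ⟩
      Q + Q + (stepCost + length cs * stepCost)       ∎)
    where
      open ≤-Reasoning
      lem : ∀ a b c → a + (b + c) ≡ b + (a + c)
      lem = solve-∀

  searchCost : ℕ
  searchCost = 1 + (Q + Q) + stepCost

  simulateServe : ∀ {x t t′ k s} → Rep B t s → BTM.Serve B x t t′ k →
                  ∃[ s′ ] ∃[ k′ ] BST.Serve x s s′ k′ × Rep B t′ s′ × k′ ≤ k * searchCost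
  simulateServe r (cs , d , tr , x∈ , refl , refl) with simulateTouching tr x∈ (r , [])
  ... | touchingRun {n₁ = n₁} {n₂} p t q r′ le with touchingTrace p t q
  ...   | cs′ , tr′ , x∈′ , len≤ = _ , _ , (cs′ , _ , tr′ , x∈′ , refl , refl) ,
    treeOf-rep (proj₁ r′) (proj₂ r′) , (begin
      length cs′                                     ≤⟨ len≤ ⟩
      suc (n₁ + n₂)                                  ≤⟨ s≤s le ⟩
      -- A search visits at least one configuration, so the single initialisation and detour may be
      -- charged to each of them.
      1 + (Q + Q) + length cs * stepCost             ≤⟨ +-monoˡ-≤ _ (m≤n*m (1 + (Q + Q)) (length cs) ⦃ nonEmpty tr ⦄) ⟩
      length cs * (1 + (Q + Q)) + length cs * stepCost ≡⟨ sym (*-distribˡ-+ (length cs) (1 + (Q + Q)) stepCost) ⟩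
      length cs * searchCost                         ∎)
    where
      open ≤-Reasoning
      nonEmpty : ∀ {c d cs} → BTM.Trace B c d cs → NonZero (length cs)
      nonEmpty (BTM.one _)    = _
      nonEmpty (BTM.cons _ _) = _

  simulateAll : ∀ {t s X k} → Rep B t s → BTM.ServeAll B t X k →
                ∃[ k′ ] BST.ServeAll s X k′ × k′ ≤ k * searchCost
  simulateAll r BTM.done = 0 , BST.done , z≤n
  simulateAll r (BTM.next {k = k} {k′} sv svs) with simulateServe r sv
  ... | _ , _ , sv′ , r′ , le with simulateAll r′ svs
  ...   | _ , svs′ , le′ = _ , BST.next sv′ svs′ ,
    ≤-trans (+-mono-≤ le le′) (≤-reflexive (sym (*-distribʳ-+ searchCost k k′)))

-- The terms linear in `ℓ` add up to 24 + 3 * 552 = 1680, and the constant 1 + 3 * 34 = 103 is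
-- absorbed by `1 ≤ ℓ`.
searchCost≤ : ∀ {ℓ} → 1 ≤ ℓ →
  (let q = 6 * ℓ; r = regroup-cost q) → 1 + (q + q) + (q + (r + (r + r)) + q) ≤ 1783 * ℓ
searchCost≤ {ℓ} 1≤ℓ rewrite sym (regroup-cost≡ (6 * ℓ)) = begin
  _                     ≡⟨ lem ℓ ⟩
  103 * 1 + 1680 * ℓ    ≤⟨ +-monoˡ-≤ (1680 * ℓ) (*-monoʳ-≤ 103 1≤ℓ) ⟩
  103 * ℓ + 1680 * ℓ    ≡⟨ sym (*-distribʳ-+ ℓ 103 1680) ⟩
  1783 * ℓ              ∎
  where
    open ≤-Reasoning
    lem : ∀ ℓ → 1 + (6 * ℓ + 6 * ℓ) + (6 * ℓ + ((92 * (6 * ℓ) + 34) +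
                ((92 * (6 * ℓ) + 34) + (92 * (6 * ℓ) + 34))) + 6 * ℓ) ≡ 103 * 1 + 1680 * ℓ
    lem = solve-∀

theorem1 : Σ ℕ λ c → (B N : ℕ) → 2 ≤ B → (X : List ℕ) → All (λ x → 1 ≤ x × x ≤ N) X →
    (t : BTree) → ValidBTree B N t → (k : ℕ) → BTM.ServeAll B t X k →
    Σ BT λ s → ValidBST N s × Σ ℕ λ k' → BST.ServeAll s X k' × k' ≤ c * (k * ⌊log₂ B ⌋)
theorem1 = 1783 , λ B N 2≤B X _ t (wf , ordered) k serves →
  let ℓ             = ⌊log₂ B ⌋
      s , r         = represent 2≤B wf
      k′ , run′ , le = Simulation.simulateAll B (6 * ℓ) 2≤B (height≤6log 2≤B) r serves
  in s , trans (inorder-rep r) ordered , k′ , run′ ,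
     ≤-trans le (≤-trans (*-monoʳ-≤ k (searchCost≤ (1≤⌊log₂⌋ 2≤B))) (≤-reflexive (swap k ℓ)))
  where
    swap : ∀ k ℓ → k * (1783 * ℓ) ≡ 1783 * (k * ℓ)
    swap k ℓ = trans (sym (*-assoc k 1783 ℓ)) (trans (cong (_* ℓ) (*-comm k 1783)) (*-assoc 1783 k ℓ))
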